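{- Let $D=\{f(a,a): a\ge 0\}$ and $S=\{p\ge 1: f(p,r)=p \text{ for some integer } r \text{ with } 0\le r<p\}$. Let $n$ be a positive integer and consider the (unique) winning opening move from the three-row Chomp rectangle $[n,n,n]$. Then: (1) No winning opening move from $[n,n,n]$ is made in the first row. (2) The winning opening move is made in the second row if and only if $n\in D$; in that case it is the move to $[n,a,a]$, where $a<n$ is the uniquely determined integer with $n=f(a,a)$. (3) The winning opening move is made in the third row if and only if $n\in S$; in that case it is the move to $[n,n,r]$, where $r<n$ is the uniquely determined integer with $f(n,r)=n$. Equivalently, the second-row values of $n$ form the OEIS sequence A029900 and the third-row values of $n$ form the OEIS sequence A029901. The first terms, in increasing order, of the two sequences of board sizes $n$ are: second row: $1,3,4,6,8,10,11,13,15,16,18,20,21,24,25,27,\ldots$; third row: $2,5,7,9,12,14,17,19,22,23,26,29,31,33,36,38,\ldots$.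
   Context: Three-row Chomp. A position is a triple $[p,q,r]$ of integers with $p\ge q\ge r\ge 0$, giving the lengths of the first, second and third rows of a left-justified board. Two players alternate moves. The moves from $[p,q,r]$ are: reduce the first row to length $a$ with $0\le a<p$ (a move made in the first row), giving $[a,\min(a,q),\min(a,r)]$; reduce the second row to length $a$ with $0\le a<q$ (a move made in the second row), giving $[p,a,\min(a,r)]$; reduce the third row to length $b$ with $0\le b<r$ (a move made in the third row), giving $[p,q,b]$. The player who moves to $[0,0,0]$ loses. A $P$-position is a position from which the previous player wins, and an $N$-position is one from which the next player wins. Equivalently: $[0,0,0]$ is an $N$-position, and a position other than $[0,0,0]$ is a $P$-position if and only if no move from it leads to a $P$-position. A move is winning if it leads to a $P$-position. The function $f$. For all integers $q\ge r\ge 0$ there is a unique integer $p>r$ such that either (i) $r<p<q$ and $[p,p,r]$ is a $P$-position, or (ii) $p\ge q$ and $[p,q,r]$ is a $P$-position. This integer is denoted $f(q,r)$. OEIS sequences. A029900 and A029901 denote the two three-row Chomp opening-move sequences: the board sizes $n$ for which $[n,n,n]$ has a winning opening move in the second row, respectively in the third row. -}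

module Defs where

open import Data.Fin.Base using (Fin; toℕ; fromℕ<)
open import Data.Fin.Properties using (pigeonhole; fromℕ<-injective; toℕ<n)
open import Data.List.Base using (List)
open import Data.List.Membership.Propositional using (_∈_)
open import Data.List.Relation.Unary.All using (All)
open import Data.List.Relation.Unary.Linked using (Linked)
open import Data.Nat.Base
open import Data.Nat.Induction using (<-wellFounded)
open import Data.Nat.Properties
open import Data.Product using (Σ; ∃; ∃!; _×_; _,_; proj₁; proj₂)
open import Data.Sum.Base using (_⊎_; inj₁; inj₂)
open import Induction.WellFounded using (Acc; acc)
open import Level using (0ℓ)
open import Relation.Binary.Definitions using (tri<; tri≈; tri>)
open import Relation.Binary.PropositionalEquality
open import Relation.Nullary using (¬_; yes; no; contradiction; recompute)
open import Relation.Unary using (Pred)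

record Position : Set where
  constructor pos
  field
    row₁ row₂ row₃ : ℕ
    .row₂≤row₁     : row₂ ≤ row₁
    .row₃≤row₂     : row₃ ≤ row₂

open Position public using (row₁; row₂; row₃)

empty : Position
empty = pos 0 0 0 z≤n z≤n

rectangle : ℕ → Position
rectangle n = pos n n n ≤-refl ≤-refl

data Row : Set where
  first second third : Row

rowLength : Position → Row → ℕ
rowLength X first  = row₁ X
rowLength X second = row₂ X
rowLength X third  = row₃ X

record Move (X : Position) : Set where
  constructor reduce
  field
    row       : Row
    newLength : ℕ
    .shorter  : newLength < rowLength X row

open Move public using (row; newLength)

play : (X : Position) → Move X → Position
play (pos p q r q≤p r≤q) (reduce first  a a<p) =
  pos a (a ⊓ q) (a ⊓ r) (m⊓n≤m a q) (⊓-monoʳ-≤ a r≤q)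
play (pos p q r q≤p r≤q) (reduce second a a<q) =
  pos p a (a ⊓ r) (≤-trans (<⇒≤ a<q) q≤p) (m⊓n≤m a r)
play (pos p q r q≤p r≤q) (reduce third  b b<r) =
  pos p q b q≤p (≤-trans (<⇒≤ b<r) r≤q)

-- P X: the previous player wins; N X: the next player wins.  Whoever moves
-- to the empty board loses, hence emptyN and the inequation in allN.
data P : Position → Set
data N : Position → Set

data P where
  allN : ∀ {X} → X ≢ empty → (∀ (m : Move X) → N (play X m)) → P X

data N where
  emptyN : N empty
  toP    : ∀ {X} (m : Move X) → P (play X m) → N X

Winning : {X : Position} → Move X → Set
Winning {X} m = P (play X m)

P⇒¬N : ∀ {X} → P X → ¬ N X
P⇒¬N (allN X≢∅ _) emptyN    = X≢∅ refl
P⇒¬N (allN _ h)   (toP m w) = P⇒¬N w (h m)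

private
  allBelow : ∀ {A : Set} {B : ℕ → Set} n →
             (∀ i → .(i < n) → A ⊎ B i) → A ⊎ (∀ i → .(i < n) → B i)
  allBelow zero h = inj₂ λ i ()
  allBelow {A} {B} (suc n) h
    with h n (n<1+n n) | allBelow {A} {B} n (λ i i<n → h i (m<n⇒m<1+n i<n))
  ... | inj₁ a | _      = inj₁ a
  ... | inj₂ _ | inj₁ a = inj₁ a
  ... | inj₂ b | inj₂ g = inj₂ go
    where
    go : ∀ i → .(i < suc n) → B i
    go i i<1+n with i ≟ n
    ... | yes refl = b
    ... | no i≢n   = g i (≤∧≢⇒< (≤-pred i<1+n) i≢n)

  size : Position → ℕ
  size X = row₁ X + (row₂ X + row₃ X)

  play-size : ∀ X (m : Move X) → size (play X m) < size X
  play-size (pos p q r _ _) (reduce first a a<p) =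
    +-mono-<-≤ (recompute (_ <? _) a<p) (+-mono-≤ (m⊓n≤n a q) (m⊓n≤n a r))
  play-size (pos p q r _ _) (reduce second a a<q) =
    +-monoʳ-< p (+-mono-<-≤ (recompute (_ <? _) a<q) (m⊓n≤n a r))
  play-size (pos p q r _ _) (reduce third b b<r) =
    +-monoʳ-< p (+-monoʳ-< q (recompute (_ <? _) b<r))

  anyMove : ∀ X → (∀ (m : Move X) → P (play X m) ⊎ N (play X m)) →
            N X ⊎ (∀ (m : Move X) → N (play X m))
  anyMove X h with inRow first | inRow second | inRow third
    where
    inRow : ∀ i → N X ⊎ (∀ a → .(a < rowLength X i) →
                         .(a< : a < rowLength X i) → N (play X (reduce i a a<)))
    inRow i = allBelow (rowLength X i) λ a a< → one a a<
      where
      one : ∀ a → .(a < rowLength X i) →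
            N X ⊎ (.(a< : a < rowLength X i) → N (play X (reduce i a a<)))
      one a a< with h (reduce i a a<)
      ... | inj₁ w = inj₁ (toP (reduce i a a<) w)
      ... | inj₂ l = inj₂ λ _ → l
  ... | inj₁ w | _      | _      = inj₁ w
  ... | inj₂ _ | inj₁ w | _      = inj₁ w
  ... | inj₂ _ | inj₂ _ | inj₁ w = inj₁ w
  ... | inj₂ g₁ | inj₂ g₂ | inj₂ g₃ = inj₂ λ where
    (reduce first  a a<) → g₁ a a< a<
    (reduce second a a<) → g₂ a a< a<
    (reduce third  a a<) → g₃ a a< a<

  empty? : ∀ X → X ≡ empty ⊎ X ≢ empty
  empty? (pos (suc _) _ _ _ _) = inj₂ λ ()
  empty? (pos zero q r q≤p r≤q)
    with refl ← n≤0⇒n≡0 (recompute (q ≤? 0) q≤p)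
    with refl ← n≤0⇒n≡0 (recompute (r ≤? 0) r≤q) = inj₁ refl

  P⊎N-acc : ∀ X → Acc _<_ (size X) → P X ⊎ N X
  P⊎N-acc X (acc rec) with empty? X
  ... | inj₁ refl = inj₂ emptyN
  ... | inj₂ X≢∅ with anyMove X (λ m → P⊎N-acc (play X m) (rec (play-size X m)))
  ...   | inj₁ n = inj₂ n
  ...   | inj₂ h = inj₁ (allN X≢∅ h)

P⊎N : ∀ X → P X ⊎ N X
P⊎N X = P⊎N-acc X (<-wellFounded (size X))

-- IsF q r r≤q p: p has the property that characterises f(q,r) uniquely.
IsF : (q r : ℕ) → .(r ≤ q) → ℕ → Set
IsF q r r≤q p = Σ (r < p) λ r<p →
    (p < q × P (pos p p r ≤-refl (<⇒≤ r<p)))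
  ⊎ Σ (q ≤ p) λ q≤p → P (pos p q r q≤p r≤q)

private
  P-cong : ∀ {p q r q′ r′} → q ≡ q′ → r ≡ r′ →
           .{q≤p : q ≤ p} .{r≤q : r ≤ q} .{q′≤p : q′ ≤ p} .{r′≤q′ : r′ ≤ q′} →
           P (pos p q r q≤p r≤q) → P (pos p q′ r′ q′≤p r′≤q′)
  P-cong refl refl w = w

  ¬P-rectangle : ∀ a → ¬ P (rectangle a)
  ¬P-rectangle zero    (allN X≢∅ _) = X≢∅ refl
  ¬P-rectangle (suc a) w@(allN _ h) with h (reduce third a ≤-refl)
  ... | toP (reduce first c c<) v =
    P⇒¬N w (toP (reduce first c c<) (P-cong refl (trans (m≤n⇒m⊓n≡m c≤a) (sym (m≤n⇒m⊓n≡m (m≤n⇒m≤1+n c≤a)))) v))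
    where c≤a = ≤-pred (recompute (_ <? _) c<)
  ... | toP (reduce second c c<) v =
    P⇒¬N w (toP (reduce second c c<) (P-cong refl (trans (m≤n⇒m⊓n≡m c≤a) (sym (m≤n⇒m⊓n≡m (m≤n⇒m≤1+n c≤a)))) v))
    where c≤a = ≤-pred (recompute (_ <? _) c<)
  ... | toP (reduce third c c<) v = P⇒¬N w (toP (reduce third c (m<n⇒m<1+n c<)) v)

  P-unique₁ : ∀ {p p′ q r} .{q≤p : q ≤ p} .{q≤p′ : q ≤ p′} .{r≤q : r ≤ q} → p < p′ →
              P (pos p q r q≤p r≤q) → ¬ P (pos p′ q r q≤p′ r≤q)
  P-unique₁ {p} {p′} {q} {r} {q≤p} {r≤q = r≤q} p<p′ w w′ =
    P⇒¬N w′ (toP (reduce first p p<p′)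
      (P-cong (sym (m≥n⇒m⊓n≡n q≤p₁)) (sym (m≥n⇒m⊓n≡n (≤-trans (recompute (r ≤? q) r≤q) q≤p₁))) w))
    where q≤p₁ = recompute (q ≤? p) q≤p

  IsF-< : ∀ {q r p p′} .(r≤q : r ≤ q) → p < p′ → IsF q r r≤q p → ¬ IsF q r r≤q p′
  IsF-< _ p<p′ (r<p , inj₁ (p<q , w)) (_ , inj₁ (_ , w′)) =
    P⇒¬N w′ (toP (reduce first _ p<p′)
      (P-cong (sym (m≤n⇒m⊓n≡m (<⇒≤ p<p′))) (sym (m≥n⇒m⊓n≡n (<⇒≤ r<p))) w))
  IsF-< _ p<p′ (r<p , inj₁ (p<q , w)) (_ , inj₂ (_ , w′)) =
    P⇒¬N w′ (toP (reduce first _ p<p′)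
      (P-cong (sym (m≤n⇒m⊓n≡m (<⇒≤ p<q))) (sym (m≥n⇒m⊓n≡n (<⇒≤ r<p))) w))
  IsF-< _ p<p′ (_ , inj₂ (q≤p , _)) (_ , inj₁ (p′<q , _)) =
    contradiction (<-trans p<p′ p′<q) (≤⇒≯ q≤p)
  IsF-< _ p<p′ (_ , inj₂ (_ , w)) (_ , inj₂ (_ , w′)) = P-unique₁ p<p′ w w′

IsF-unique : ∀ {q r p p′} .(r≤q : r ≤ q) → IsF q r r≤q p → IsF q r r≤q p′ → p ≡ p′
IsF-unique {p = p} {p′} r≤q h h′ with <-cmp p p′
... | tri< p<p′ _ _ = contradiction h′ (IsF-< r≤q p<p′ h)
... | tri≈ _ p≡p′ _ = p≡p′
... | tri> _ _ p′<p = contradiction h (IsF-< r≤q p′<p h′)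

-- For p > q, a winning move of [p,q,r] in the second or third row determines p,
-- and there are only q + r such moves; so the q + r + 1 values
-- p = q + 1, …, 2q + r + 1 cannot all admit one.
private
  module Existence (q r : ℕ) .(r≤q₀ : r ≤ q) where

    r≤q : r ≤ q
    r≤q = recompute (r ≤? q) r≤q₀

    board : ∀ p → .(q < p) → Position
    board p q<p = pos p q r (<⇒≤ q<p) r≤q

    -- The natural number codes the move: a stands for itself, b for q + b.
    data Lower (p : ℕ) .(q<p : q < p) (k : ℕ) : Set where
      inSecond : (k<q : k < q) → Winning {board p q<p} (reduce second k k<q) → Lower p q<p k
      inThird  : ∀ b (b<r : b < r) → k ≡ q + b →
                 Winning {board p q<p} (reduce third b b<r) → Lower p q<p k

    Lower-bound : ∀ {p k} .{q<p : q < p} → Lower p q<p k → k < q + r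
    Lower-bound (inSecond k<q _)       = <-≤-trans k<q (m≤m+n q r)
    Lower-bound (inThird b b<r refl _) = +-monoʳ-< q b<r

    Lower-< : ∀ {p p′ k} .{q<p : q < p} .{q<p′ : q < p′} → p < p′ →
              Lower p q<p k → ¬ Lower p′ q<p′ k
    Lower-< p<p′ (inSecond _ w) (inSecond _ w′) = P-unique₁ p<p′ w w′
    Lower-< p<p′ (inThird b _ e w) (inThird b′ _ e′ w′)
      with refl ← +-cancelˡ-≡ q b b′ (trans (sym e) e′) = P-unique₁ p<p′ w w′
    Lower-< _ (inSecond q+b<q _) (inThird _ _ refl _) = m+n≮m q _ q+b<q
    Lower-< _ (inThird _ _ refl _) (inSecond q+b<q _) = m+n≮m q _ q+b<q

    step : ∀ p → .(q<p : q < p) → ∃ (IsF q r r≤q) ⊎ ∃ (Lower p q<p)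
    step p q<p with P⊎N (board p q<p)
    ... | inj₁ w = inj₁ (p , ≤-<-trans r≤q q<p₁ , inj₂ (<⇒≤ q<p₁ , w))
      where q<p₁ = recompute (q <? p) q<p
    ... | inj₂ (toP (reduce second a a<q) w) = inj₂ (a , inSecond (recompute (_ <? _) a<q) w)
    ... | inj₂ (toP (reduce third b b<r) w)  = inj₂ (q + b , inThird b (recompute (_ <? _) b<r) refl w)
    ... | inj₂ (toP (reduce first a _) w) with r <? a
    ...   | no r≮a = contradiction
              (P-cong (m≤n⇒m⊓n≡m (≤-trans a≤r r≤q)) (m≤n⇒m⊓n≡m a≤r) w)
              (¬P-rectangle a)
      where a≤r = ≮⇒≥ r≮a
    ...   | yes r<a with q ≤? a
    ...     | yes q≤a = inj₁ (a , r<a , inj₂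
                (q≤a , P-cong (m≥n⇒m⊓n≡n q≤a) (m≥n⇒m⊓n≡n (<⇒≤ r<a)) w))
    ...     | no q≰a  = inj₁ (a , r<a , inj₁
                (≰⇒> q≰a , P-cong (m≤n⇒m⊓n≡m (<⇒≤ (≰⇒> q≰a))) (m≥n⇒m⊓n≡n (<⇒≤ r<a)) w))

    existence : ∃ (IsF q r r≤q)
    existence with allBelow {B = λ i → ∃ (Lower (suc q + i) (s≤s (m≤m+n q i)))} (suc (q + r))
                     (λ i _ → step (suc q + i) (s≤s (m≤m+n q i)))
    ... | inj₁ found = found
    ... | inj₂ lower =
      let low : (i : Fin (suc (q + r))) → ∃ (Lower (suc q + toℕ i) (s≤s (m≤m+n q (toℕ i))))
          low i = lower (toℕ i) (toℕ<n i)
          i , j , i<j , eq = pigeonhole ≤-refl (λ i → fromℕ< (Lower-bound (proj₂ (low i))))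
      in contradiction (subst (Lower _ _) (sym (fromℕ<-injective _ _ _ _ eq)) (proj₂ (low j)))
           (Lower-< (+-monoʳ-< (suc q) i<j) (proj₂ (low i)))

f-defined : ∀ q r → .(r≤q : r ≤ q) → ∃! _≡_ (IsF q r r≤q)
f-defined q r r≤q with Existence.existence q r r≤q
... | p , h = p , h , IsF-unique r≤q h

f : ∀ q r → .(r ≤ q) → ℕ
f q r r≤q = proj₁ (f-defined q r r≤q)

D : Pred ℕ 0ℓ
D n = ∃ λ a → f a a ≤-refl ≡ n

S : Pred ℕ 0ℓ
S p = 1 ≤ p × ∃ λ r → Σ (r < p) λ r<p → f p r (<⇒≤ r<p) ≡ p

WinsInRow : Row → Pred ℕ 0ℓ
WinsInRow i n = 1 ≤ n × ∃ λ (m : Move (rectangle n)) → Winning m × row m ≡ i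

-- Each sequence is identified with the set of its terms.
A029900 A029901 : Pred ℕ 0ℓ
A029900 = WinsInRow second
A029901 = WinsInRow third

-- xs is an initial segment of the increasing enumeration of A.
record FirstTerms (A : Pred ℕ 0ℓ) (xs : List ℕ) : Set where
  field
    increasing : Linked _<_ xs
    members    : All A xs
    complete   : ∀ {n} → A n → n ∈ xs ⊎ All (_< n) xs

{-# OPTIONS --safe #-}
-- The heart of the matter is that [n,a,a] and [n,n,r] are not both P-positions.
-- For r ≥ a the first is reached from the second.  For r < a one shows that if
-- [n,n,r] is a P-position then every [n,q,r] with r ≤ q < n has a winning move in
-- its third row (lemma coverRow); for q = a this is a position [n,a,c] with c < a,
-- which is reached from [n,a,a].
module Submission where

open import Defs
open import Data.Fin.Base using (Fin; toℕ; fromℕ<)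
open import Data.Fin.Properties using (pigeonhole; fromℕ<-injective; toℕ<n)
open import Data.List.Base using (List; []; _∷_)
open import Data.List.Membership.Propositional using (_∈_)
open import Data.List.Relation.Unary.All as All using (All)
open import Data.List.Relation.Unary.Linked using (Linked; linked?)
open import Data.Nat.Base
open import Data.Nat.Properties
open import Data.List.Membership.DecPropositional _≟_ using (_∈?_)
open import Data.Product using (Σ; ∃; ∃!; _×_; _,_; proj₁; proj₂)
open import Data.Sum.Base using (_⊎_; inj₁; inj₂)
open import Function.Base using (_∘_)
open import Function.Bundles using (_⇔_; mk⇔)
open import Relation.Binary.Definitions using (tri<; tri≈; tri>)
open import Relation.Binary.PropositionalEquality
open import Relation.Nullary using (¬_; Dec; yes; no; contradiction; recompute)
open import Relation.Nullary.Decidable using (_×-dec_; _⊎-dec_; ¬?; toWitness)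
open import Relation.Unary using (_≐_)

-- P-positions indexed by row lengths.

-- The inequalities inside `pos` are irrelevant. Bundling relevant copies with the P-proof lets
-- positions be named by bare numbers and their bounds be extracted.
IsP : ℕ → ℕ → ℕ → Set
IsP p q r = Σ (q ≤ p) λ q≤p → Σ (r ≤ q) λ r≤q → P (pos p q r q≤p r≤q)

pos-cong : ∀ {p q r p′ q′ r′} → p ≡ p′ → q ≡ q′ → r ≡ r′ →
           .{a : q ≤ p} .{b : r ≤ q} .{a′ : q′ ≤ p′} .{b′ : r′ ≤ q′} →
           pos p q r a b ≡ pos p′ q′ r′ a′ b′
pos-cong refl refl refl = refl

toIsP : ∀ {p q r} .{q≤p : q ≤ p} .{r≤q : r ≤ q} → P (pos p q r q≤p r≤q) → IsP p q r
toIsP {p} {q} {r} {q≤p} {r≤q} w = recompute (q ≤? p) q≤p , recompute (r ≤? q) r≤q , w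

fromIsP : ∀ {p q r} .{q≤p : q ≤ p} .{r≤q : r ≤ q} → IsP p q r → P (pos p q r q≤p r≤q)
fromIsP (_ , _ , w) = w

isP? : ∀ p q r → Dec (IsP p q r)
isP? p q r with q ≤? p | r ≤? q
... | no q≰p  | _       = no (q≰p ∘ proj₁)
... | yes _   | no r≰q  = no (r≰q ∘ proj₁ ∘ proj₂)
... | yes q≤p | yes r≤q with P⊎N (pos p q r q≤p r≤q)
...   | inj₁ w = yes (toIsP w)
...   | inj₂ l = no λ w → P⇒¬N (fromIsP w) l

¬IsP-first : ∀ {p q r a} → IsP p q r → a < p → ¬ IsP a (a ⊓ q) (a ⊓ r)
¬IsP-first (_ , _ , w) a<p v = P⇒¬N w (toP (reduce first _ a<p) (fromIsP v))

¬IsP-second : ∀ {p q r a} → IsP p q r → a < q → ¬ IsP p a (a ⊓ r)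
¬IsP-second (_ , _ , w) a<q v = P⇒¬N w (toP (reduce second _ a<q) (fromIsP v))

¬IsP-third : ∀ {p q r b} → IsP p q r → b < r → ¬ IsP p q b
¬IsP-third (_ , _ , w) b<r v = P⇒¬N w (toP (reduce third _ b<r) (fromIsP v))

reply : ∀ {p q r} → 0 < p → q ≤ p → r ≤ q → ¬ IsP p q r →
        (∃ λ a → a < p × IsP a (a ⊓ q) (a ⊓ r))
      ⊎ (∃ λ a → a < q × IsP p a (a ⊓ r))
      ⊎ (∃ λ b → b < r × IsP p q b)
reply {p} {q} {r} 0<p q≤p r≤q ¬w with P⊎N (pos p q r q≤p r≤q)
... | inj₁ w = contradiction (toIsP w) ¬w
... | inj₂ emptyN = contradiction 0<p (n≮n 0)
... | inj₂ (toP (reduce first  a a<p) w) = inj₁ (a , recompute (a <? p) a<p , toIsP w)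
... | inj₂ (toP (reduce second a a<q) w) = inj₂ (inj₁ (a , recompute (a <? q) a<q , toIsP w))
... | inj₂ (toP (reduce third  b b<r) w) = inj₂ (inj₂ (b , recompute (b <? r) b<r , toIsP w))

IsP-resp : ∀ {p q r q′ r′} → q ≡ q′ → r ≡ r′ → IsP p q r → IsP p q′ r′
IsP-resp refl refl w = w

third-unique : ∀ {p q r r′} → IsP p q r → IsP p q r′ → r ≡ r′
third-unique {r = r} {r′} w w′ with <-cmp r r′
... | tri< r<r′ _ _ = contradiction w (¬IsP-third w′ r<r′)
... | tri≈ _ r≡r′ _ = r≡r′
... | tri> _ _ r′<r = contradiction w′ (¬IsP-third w r′<r)

-- Strategy stealing: were the rectangle a P-position, biting off its corner would leave an
-- N-position. The winning answer to that bite can be played from the rectangle itself, with the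
-- same result.
¬IsP-rectangle : ∀ n → ¬ IsP n n n
¬IsP-rectangle zero (_ , _ , allN X≢∅ _) = X≢∅ refl
¬IsP-rectangle (suc n) w with reply z<s ≤-refl (n≤1+n n) (¬IsP-third w (n<1+n n))
-- As `a ≤ n`, cutting to `a` leaves the same third row whether it had length `n` or `suc n`.
... | inj₁ (a , a<1+n , v) = ¬IsP-first w a<1+n
        (IsP-resp refl (trans (m≤n⇒m⊓n≡m (≤-pred a<1+n)) (sym (m≤n⇒m⊓n≡m (<⇒≤ a<1+n)))) v)
... | inj₂ (inj₁ (a , a<1+n , v)) = ¬IsP-second w a<1+n
        (IsP-resp refl (trans (m≤n⇒m⊓n≡m (≤-pred a<1+n)) (sym (m≤n⇒m⊓n≡m (<⇒≤ a<1+n)))) v)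
... | inj₂ (inj₂ (b , b<n , v)) = ¬IsP-third w (m<n⇒m<1+n b<n) v

-- Covering the positions below a P-position [n,n,r].

module _ {n r} (w : IsP n n r) where

  Covered : ℕ → Set
  Covered q = ∃ λ c → c < r × IsP n q c

  -- If c(q′) is the third row of the P-position found for q < q′ ≤ n, then the
  -- position [n,q,c(q′)] can only be won by a move in its third row, or by a move to
  -- some [m,q,c(q′)] with q < m < n.  The n ∸ q numbers c(q′) are distinct, so that
  -- the n ∸ q ∸ 1 values of m cannot serve all of them.
  coverRow-step : ∀ q → r ≤ q → q < n → (∀ {q′} → q < q′ → q′ < n → Covered q′) → Covered q
  coverRow-step q r≤q q<n covered with anyUpTo? (isP? n q) r
  ... | yes found = found
  ... | no none =
    let i , j , i<j , eq = pigeonhole fewer (λ i → fromℕ< (code-< i))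
        m≡m′ = trans (sym (reconstruct i)) (trans (cong (suc q +_) (fromℕ<-injective _ _ _ _ eq)) (reconstruct j))
    in collision i j i<j m≡m′
    where
    row₂-at : Fin (n ∸ q) → ℕ
    row₂-at i = suc (q + toℕ i)

    row₂-at-≤ : ∀ i → row₂-at i ≤ n
    row₂-at-≤ i = subst (suc (q + toℕ i) ≤_) (m+[n∸m]≡n (<⇒≤ q<n)) (+-monoʳ-< q (toℕ<n i))

    sheet : ∀ i → ∃ λ c → c ≤ r × IsP n (row₂-at i) c
    sheet i with m≤n⇒m<n∨m≡n (row₂-at-≤ i)
    -- The topmost row `q′ = n` is served by `w` itself, with third row `r`; hence the bound on `c`
    -- is not strict.
    ... | inj₂ eq = r , ≤-refl , IsP-resp (sym eq) refl w
    ... | inj₁ lt with covered (s≤s (m≤m+n q _)) lt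
    ...   | c , c<r , v = c , <⇒≤ c<r , v

    c : Fin (n ∸ q) → ℕ
    c i = proj₁ (sheet i)

    c≤q : ∀ i → c i ≤ q
    c≤q i = ≤-trans (proj₁ (proj₂ (sheet i))) r≤q

    inRow : ∀ i → IsP n (row₂-at i) (c i)
    inRow i = proj₂ (proj₂ (sheet i))

    -- Used twice: `a = q` shows that [n,q,c i] is not a P-position, and `a < q` excludes a winning
    -- answer to it in the second row.
    shrink : ∀ i {a} → a ≤ q → IsP n a (a ⊓ c i) → ∀ {A : Set} → A
    shrink i a≤q v = contradiction v (¬IsP-second (inRow i) (s≤s (≤-trans a≤q (m≤m+n q _))))

    answer : ∀ i → ∃ λ m → q < m × m < n × IsP m q (c i)
    answer i with reply (≤-<-trans z≤n q<n) (<⇒≤ q<n) (c≤q i)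
                   (λ v → shrink i ≤-refl (IsP-resp refl (sym (m≥n⇒m⊓n≡n (c≤q i))) v))
    ... | inj₂ (inj₁ (a , a<q , v)) = shrink i (<⇒≤ a<q) v
    ... | inj₂ (inj₂ (b , b<c , v)) =
      contradiction (b , <-≤-trans b<c (proj₁ (proj₂ (sheet i))) , v) none
    ... | inj₁ (m , m<n , v) with m ≤? q
    ...   | no m≰q = m , q<m , m<n ,
              IsP-resp (m≥n⇒m⊓n≡n (<⇒≤ q<m)) (m≥n⇒m⊓n≡n (≤-trans (c≤q i) (<⇒≤ q<m))) v
      where q<m = ≰⇒> m≰q
    -- A cut to `m ≤ q` levels the second row to `m`, whether it was `q` or `row₂-at i`, so the
    -- result is also reachable from the P-position `inRow i`.
    ...   | yes m≤q = contradiction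
              (IsP-resp (trans (m≤n⇒m⊓n≡m m≤q) (sym (m≤n⇒m⊓n≡m (≤-trans m≤q (<⇒≤ (s≤s (m≤m+n q _))))))) refl v)
              (¬IsP-first (inRow i) m<n)

    -- The possible `m` are `suc q`, ..., `n ∸ 1`; subtracting `suc q` numbers them from 0.
    code : Fin (n ∸ q) → ℕ
    code i = proj₁ (answer i) ∸ suc q

    reconstruct : ∀ i → suc q + code i ≡ proj₁ (answer i)
    reconstruct i = m+[n∸m]≡n (proj₁ (proj₂ (answer i)))

    code-< : ∀ i → code i < n ∸ suc q
    code-< i = ∸-monoˡ-< (proj₁ (proj₂ (proj₂ (answer i)))) (proj₁ (proj₂ (answer i)))

    fewer : n ∸ suc q < n ∸ q
    fewer = ∸-monoʳ-< (n<1+n q) q<n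

    -- A shared `m` forces `c i ≡ c j`, and then a second-row move joins the two P-positions
    -- `inRow j` and `inRow i`.
    collision : ∀ i j → toℕ i < toℕ j → proj₁ (answer i) ≡ proj₁ (answer j) → Covered q
    collision i j i<j m≡m′ = contradiction
      (IsP-resp refl (trans c≡c′ (sym (m≥n⇒m⊓n≡n (≤-trans (c≤q j) (<⇒≤ (s≤s (m≤m+n q _))))))) (inRow i))
      (¬IsP-second (inRow j) (s≤s (+-monoʳ-< q i<j)))
      where
      c≡c′ : c i ≡ c j
      c≡c′ = third-unique (proj₂ (proj₂ (proj₂ (answer i))))
               (subst (λ m → IsP m q (c j)) (sym m≡m′) (proj₂ (proj₂ (proj₂ (answer j)))))

  -- Downward induction on `q`, with `k` bounding the distance to `n`. For `q` just below `n` the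
  -- induction hypothesis is vacuous.
  coverRow-from : ∀ k q → n ≤ k + q → r ≤ q → q < n → Covered q
  coverRow-from zero    q n≤q   _   q<n = contradiction q<n (≤⇒≯ n≤q)
  coverRow-from (suc k) q n≤k+q r≤q q<n = coverRow-step q r≤q q<n λ {q′} q<q′ q′<n →
    coverRow-from k q′ (≤-trans n≤k+q (subst (_≤ k + q′) (+-suc k q) (+-monoʳ-≤ k q<q′)))
      (≤-trans r≤q (<⇒≤ q<q′)) q′<n

  coverRow : ∀ {q} → r ≤ q → q < n → ∃ λ c → c < r × IsP n q c
  coverRow {q} = coverRow-from n q (m≤m+n n q)

-- Uniqueness and mutual exclusion of [n,a,a] and [n,n,r].

diagonal-unique : ∀ {n a b} → IsP n a a → IsP n b b → a ≡ b
diagonal-unique {n} {a} {b} v w with <-cmp a b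
... | tri< a<b _ _ = contradiction (IsP-resp refl (sym (m≤n⇒m⊓n≡m (<⇒≤ a<b))) v) (¬IsP-second w a<b)
... | tri≈ _ a≡b _ = a≡b
... | tri> _ _ b<a = contradiction (IsP-resp refl (sym (m≤n⇒m⊓n≡m (<⇒≤ b<a))) w) (¬IsP-second v b<a)

diagonal-< : ∀ {n a} → IsP n a a → a < n
diagonal-< {n} v = ≤∧≢⇒< (proj₁ v) λ where refl → ¬IsP-rectangle n v

diagonal-exclusive : ∀ {n a r} → IsP n a a → ¬ IsP n n r
diagonal-exclusive {a = a} {r} v w with a ≤? r
... | yes a≤r = ¬IsP-second w (diagonal-< v) (IsP-resp refl (sym (m≤n⇒m⊓n≡m a≤r)) v)
... | no a≰r with coverRow w (<⇒≤ (≰⇒> a≰r)) (diagonal-< v)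
...   | c , c<r , u = ¬IsP-third v (<-trans c<r (≰⇒> a≰r)) u

-- Values of `f` as P-positions.

f-unique : ∀ {q r p} .(r≤q : r ≤ q) → IsF q r r≤q p → f q r r≤q ≡ p
f-unique {q} {r} r≤q h = proj₂ (proj₂ (f-defined q r r≤q)) h

f-spec : ∀ q r .(r≤q : r ≤ q) → IsF q r r≤q (f q r r≤q)
f-spec q r r≤q = proj₁ (proj₂ (f-defined q r r≤q))

diagonal⇒f : ∀ {n a} → IsP n a a → f a a ≤-refl ≡ n
diagonal⇒f v@(a≤n , _ , w) = f-unique ≤-refl (diagonal-< v , inj₂ (a≤n , w))

-- For `q = r = a` alternative (i) in the definition of `f` would need `a < n < a`, so only (ii)
-- remains.
f⇒diagonal : ∀ {n} a → f a a ≤-refl ≡ n → IsP n a a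
f⇒diagonal a eq with subst (IsF a a ≤-refl) eq (f-spec a a ≤-refl)
... | a<n , inj₁ (n<a , _) = contradiction a<n (<-asym n<a)
... | _   , inj₂ (_ , w)   = toIsP w

last⇒f : ∀ {n r} (r<n : r < n) → IsP n n r → f n r (<⇒≤ r<n) ≡ n
last⇒f r<n w = f-unique (<⇒≤ r<n) (r<n , inj₂ (≤-refl , fromIsP w))

f⇒last : ∀ {n} r (r<n : r < n) → f n r (<⇒≤ r<n) ≡ n → IsP n n r
f⇒last {n} r r<n eq with subst (IsF n r (<⇒≤ r<n)) eq (f-spec n r (<⇒≤ r<n))
... | _ , inj₁ (n<n , _) = contradiction n<n (n≮n n)
... | _ , inj₂ (_ , w)   = toIsP w

last-< : ∀ {n r} → IsP n n r → r < n
last-< {n} w = ≤∧≢⇒< (proj₁ (proj₂ w)) λ where refl → ¬IsP-rectangle n w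

-- Winning opening moves from the rectangle.

-- A first-row cut of a rectangle leaves a smaller rectangle, never a P-position, so there is no
-- constructor for the first row. In the second row the third is clipped along, which gives [n,a,a].
data WinningView {n} : Move (rectangle n) → Set where
  diagonal : ∀ {a} .(a<n : a < n) → IsP n a a → WinningView (reduce second a a<n)
  last     : ∀ {r} .(r<n : r < n) → IsP n n r → WinningView (reduce third r r<n)

view : ∀ {n} (m : Move (rectangle n)) → Winning m → WinningView m
view {n} (reduce first a a<n) w = contradiction
  (IsP-resp a⊓n≡a a⊓n≡a (toIsP w)) (¬IsP-rectangle a)
  where a⊓n≡a = m≤n⇒m⊓n≡m (<⇒≤ (recompute (a <? n) a<n))
view {n} (reduce second a a<n) w = diagonal a<n
  (IsP-resp refl (m≤n⇒m⊓n≡m (<⇒≤ (recompute (a <? n) a<n))) (toIsP w))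
view (reduce third r r<n) w = last r<n (toIsP w)

diagonal-wins : ∀ {n a} → IsP n a a → .(a<n : a < n) → Winning {rectangle n} (reduce second a a<n)
diagonal-wins {n} {a} v a<n =
  fromIsP (IsP-resp refl (sym (m≤n⇒m⊓n≡m (<⇒≤ (recompute (a <? n) a<n)))) v)

-- The field `shorter` is irrelevant, so equal rows and equal new lengths already make the moves
-- definitionally equal.
views-agree : ∀ {n} {m m′ : Move (rectangle n)} → WinningView m → WinningView m′ → m ≡ m′
views-agree (diagonal _ v) (diagonal _ v′) with refl ← diagonal-unique v v′ = refl
views-agree (diagonal _ v) (last _ w)      = contradiction w (diagonal-exclusive v)
views-agree (last _ w)     (diagonal _ v)  = contradiction w (diagonal-exclusive v)
views-agree (last _ w)     (last _ w′)     with refl ← third-unique w w′ = refl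

opening-unique : ∀ n → 1 ≤ n → ∃! _≡_ (Winning {rectangle n})
opening-unique n 1≤n with P⊎N (rectangle n)
... | inj₁ w = contradiction (toIsP w) (¬IsP-rectangle n)
... | inj₂ l = go l 1≤n
  where
  go : ∀ {n} → N (rectangle n) → 1 ≤ n → ∃! _≡_ (Winning {rectangle n})
  go emptyN    1≤0 = contradiction 1≤0 (n≮n 0)
  go (toP m w) _   = m , w , λ {m′} w′ → views-agree (view m w) (view m′ w′)

IsP⇒D : ∀ {n a} → IsP n a a → D n
IsP⇒D {a = a} v = a , diagonal⇒f v

IsP⇒S : ∀ {n r} → IsP n n r → S n
IsP⇒S {r = r} w = ≤-<-trans z≤n (last-< w) , r , last-< w , last⇒f (last-< w) w

DS-disjoint : ∀ {n} → D n → ¬ S n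
DS-disjoint (a , fa≡n) (_ , r , r<n , fr≡n) =
  diagonal-exclusive (f⇒diagonal a fa≡n) (f⇒last r r<n fr≡n)

A029900≐D : A029900 ≐ D
A029900≐D = to , λ (a , fa≡n) → from (f⇒diagonal a fa≡n)
  where
  to : ∀ {n} → A029900 n → D n
  to (_ , m , w , eq) with view m w | eq
  ... | diagonal _ v | refl = IsP⇒D v
  from : ∀ {n a} → IsP n a a → A029900 n
  from {a = a} v = ≤-<-trans z≤n (diagonal-< v) , reduce second a (diagonal-< v) , diagonal-wins v (diagonal-< v) , refl

A029901≐S : A029901 ≐ S
A029901≐S = to , λ (1≤n , r , r<n , fr≡n) → 1≤n , reduce third r r<n , fromIsP (f⇒last r r<n fr≡n) , refl
  where
  to : ∀ {n} → A029901 n → S n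
  to (_ , m , w , eq) with view m w | eq
  ... | last _ w′ | refl = IsP⇒S w′

opening : ∀ {n} {m : Move (rectangle n)} → WinningView m →
    row m ≢ first
  × (row m ≡ second ⇔ D n)
  × (row m ≡ second →
        ∃! _≡_ (λ a → n ≡ f a a ≤-refl)
      × ((a : ℕ) → n ≡ f a a ≤-refl →
           Σ (a < n) λ a<n → play (rectangle n) m ≡ pos n a a (<⇒≤ a<n) ≤-refl))
  × (row m ≡ third ⇔ S n)
  × (row m ≡ third →
        ∃! _≡_ (λ r → Σ (r < n) λ r<n → f n r (<⇒≤ r<n) ≡ n)
      × ((r : ℕ) (r<n : r < n) → f n r (<⇒≤ r<n) ≡ n →
           play (rectangle n) m ≡ pos n n r ≤-refl (<⇒≤ r<n)))
opening (diagonal {a} a<n v) =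
      (λ ())
    , mk⇔ (λ _ → IsP⇒D v) (λ _ → refl)
    , (λ _ → (a , sym (diagonal⇒f v) , λ {b} eq → diagonal-unique v (f⇒diagonal b (sym eq)))
           , λ b eq → let u = f⇒diagonal b (sym eq)
                          a≡b = diagonal-unique v u in
               diagonal-< u
             , pos-cong refl a≡b (trans (m≤n⇒m⊓n≡m (proj₁ v)) a≡b))
    , mk⇔ (λ ()) (λ s → contradiction s (DS-disjoint (IsP⇒D v)))
    , λ ()
opening (last {r} r<n v) =
      (λ ())
    , mk⇔ (λ ()) (λ d → contradiction (IsP⇒S v) (DS-disjoint d))
    , (λ ())
    , mk⇔ (λ _ → IsP⇒S v) (λ _ → refl)
    , λ _ → (r , (last-< v , last⇒f (last-< v) v)
               , λ {s} (s<n , eq) → third-unique v (f⇒last s s<n eq))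
          , λ s s<n eq → pos-cong refl refl (third-unique v (f⇒last s s<n eq))

-- Certifying a finite table of P-positions.

-- entry p q = suc r lists [p,q,r] as a P-position; entry p q = 0 says that no [p,q,r] is one.
module Table (entry : ℕ → ℕ → ℕ) where

  Listed : ℕ → ℕ → ℕ → Set
  Listed p q r = entry p q ≡ suc r

  listed? : ∀ p q r → Dec (Listed p q r)
  listed? p q r = entry p q ≟ suc r

  MoveToListed : ℕ → ℕ → ℕ → Set
  MoveToListed p q r =
      (∃ λ b → b < r × Listed p q b)
    ⊎ (∃ λ a → a < q × Listed p a (a ⊓ r))
    ⊎ (∃ λ a → a < p × Listed a (a ⊓ q) (a ⊓ r))

  moveToListed? : ∀ p q r → Dec (MoveToListed p q r)
  moveToListed? p q r =
          anyUpTo? (λ b → listed? p q b) r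
    ⊎-dec anyUpTo? (λ a → listed? p a (a ⊓ r)) q
    ⊎-dec anyUpTo? (λ a → listed? a (a ⊓ q) (a ⊓ r)) p

  -- The recursive characterisation of P-positions with `Listed` in place of `P`. For `q ≤ p` and
  -- `r ≤ q`, `p ≡ 0` singles out the empty board. The condition is local and decidable, so a
  -- bounded range can be checked by evaluation.
  Correct : ℕ → ℕ → ℕ → Set
  Correct p q r =
      (0 < p × Listed p q r × ¬ MoveToListed p q r)
    ⊎ (¬ Listed p q r × (p ≡ 0 ⊎ MoveToListed p q r))

  correct? : ∀ p q r → Dec (Correct p q r)
  correct? p q r =
          (0 <? p ×-dec listed? p q r ×-dec ¬? (moveToListed? p q r))
    ⊎-dec (¬? (listed? p q r) ×-dec (p ≟ 0 ⊎-dec moveToListed? p q r))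

  module Certified (bound : ℕ)
    (correct : ∀ {p} → p < bound → ∀ {q} → q < suc p → ∀ {r} → r < suc q → Correct p q r) where

    lookup-correct : ∀ X → row₁ X < bound → Correct (row₁ X) (row₂ X) (row₃ X)
    lookup-correct (pos p q r q≤p r≤q) p<bound =
      correct p<bound (s≤s (recompute (q ≤? p) q≤p)) (s≤s (recompute (r ≤? q) r≤q))

    ListedPos : Position → Set
    ListedPos X = Listed (row₁ X) (row₂ X) (row₃ X)

    moveTo : ∀ X → MoveToListed (row₁ X) (row₂ X) (row₃ X) → ∃ λ (m : Move X) → ListedPos (play X m)
    moveTo (pos _ _ _ _ _) (inj₁ (b , b<r , l))        = reduce third b b<r , l
    moveTo (pos _ _ _ _ _) (inj₂ (inj₁ (a , a<q , l))) = reduce second a a<q , l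
    moveTo (pos _ _ _ _ _) (inj₂ (inj₂ (a , a<p , l))) = reduce first a a<p , l

    moveFrom : ∀ X (m : Move X) → ListedPos (play X m) → MoveToListed (row₁ X) (row₂ X) (row₃ X)
    moveFrom (pos p _ _ _ _) (reduce first  a a<p) l = inj₂ (inj₂ (a , recompute (a <? p) a<p , l))
    moveFrom (pos _ q _ _ _) (reduce second a a<q) l = inj₂ (inj₁ (a , recompute (a <? q) a<q , l))
    moveFrom (pos _ _ r _ _) (reduce third  b b<r) l = inj₁ (b , recompute (b <? r) b<r , l)

    play-row₁ : ∀ X (m : Move X) → row₁ (play X m) ≤ row₁ X
    play-row₁ (pos p _ _ _ _) (reduce first  a a<p) = <⇒≤ (recompute (a <? p) a<p)
    play-row₁ (pos _ _ _ _ _) (reduce second _ _)   = ≤-refl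
    play-row₁ (pos _ _ _ _ _) (reduce third  _ _)   = ≤-refl

    row₁≡0⇒empty : ∀ X → row₁ X ≡ 0 → X ≡ empty
    row₁≡0⇒empty (pos _ q r q≤0 r≤q) refl
      with refl ← n≤0⇒n≡0 (recompute (q ≤? 0) q≤0)
      with refl ← n≤0⇒n≡0 (recompute (r ≤? 0) r≤q) = refl

    -- Mutual induction on the derivations of `P` and `N`: local correctness forces the table to
    -- follow the game recursion. No move lengthens the first row, so play stays within the bound.
    P⇒listed  : ∀ {X} → row₁ X < bound → P X → ListedPos X
    N⇒¬listed : ∀ {X} → row₁ X < bound → N X → ¬ ListedPos X

    P⇒listed {X} X<bound (allN X≢∅ h) with lookup-correct X X<bound
    ... | inj₁ (_ , l , _)        = l
    ... | inj₂ (_ , inj₁ row₁≡0)  = contradiction (row₁≡0⇒empty X row₁≡0) X≢∅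
    ... | inj₂ (_ , inj₂ reachable) with moveTo X reachable
    ...   | m , l = contradiction l (N⇒¬listed (≤-<-trans (play-row₁ X m) X<bound) (h m))

    N⇒¬listed 0<bound emptyN l with lookup-correct empty 0<bound
    ... | inj₁ (0<0 , _) = n≮n 0 0<0
    ... | inj₂ (¬l , _)  = ¬l l
    N⇒¬listed {X} X<bound (toP m w) l with lookup-correct X X<bound
    ... | inj₂ (¬l , _)        = ¬l l
    ... | inj₁ (_ , _ , stuck) =
      stuck (moveFrom X m (P⇒listed (≤-<-trans (play-row₁ X m) X<bound) w))

    listed⇒IsP : ∀ {p q r} → p < bound → q ≤ p → r ≤ q → Listed p q r → IsP p q r
    listed⇒IsP {p} {q} {r} p<bound q≤p r≤q l with P⊎N (pos p q r q≤p r≤q)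
    ... | inj₁ w = toIsP w
    ... | inj₂ v = contradiction l (N⇒¬listed p<bound v)

    InTable₂ InTable₃ : ℕ → Set
    InTable₂ n = n < bound × ∃ λ a → a < n × Listed n a a
    InTable₃ n = n < bound × ∃ λ r → r < n × Listed n n r

    inTable₂? : ∀ n → Dec (InTable₂ n)
    inTable₂? n = n <? bound ×-dec anyUpTo? (λ a → listed? n a a) n

    inTable₃? : ∀ n → Dec (InTable₃ n)
    inTable₃? n = n <? bound ×-dec anyUpTo? (listed? n n) n

    inTable₂⇒D : ∀ {n} → InTable₂ n → D n
    inTable₂⇒D (n<bound , a , a<n , l) = IsP⇒D (listed⇒IsP n<bound (<⇒≤ a<n) ≤-refl l)

    inTable₃⇒S : ∀ {n} → InTable₃ n → S n
    inTable₃⇒S (n<bound , r , r<n , l) = IsP⇒S (listed⇒IsP n<bound ≤-refl (<⇒≤ r<n) l)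

-- The table for first rows up to 38.

-- Row p of the table is a pair (k , e₀ ∷ e₁ ∷ …) in which eᵢ is the entry of
-- p and k + i; the entries not shown are 0.
table : List (ℕ × List ℕ)
table =
  (0 , []) ∷
  (0 , 1 ∷ []) ∷
  (1 , 1 ∷ 2 ∷ []) ∷
  (1 , 2 ∷ 1 ∷ []) ∷
  (2 , 3 ∷ 1 ∷ []) ∷
  (3 , 3 ∷ 1 ∷ 4 ∷ []) ∷
  (3 , 4 ∷ 3 ∷ 1 ∷ []) ∷
  (4 , 4 ∷ 3 ∷ 1 ∷ 5 ∷ []) ∷
  (4 , 5 ∷ 0 ∷ 3 ∷ 1 ∷ []) ∷
  (5 , 5 ∷ 6 ∷ 3 ∷ 1 ∷ 7 ∷ []) ∷
  (5 , 6 ∷ 5 ∷ 0 ∷ 3 ∷ 1 ∷ []) ∷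
  (6 , 7 ∷ 6 ∷ 0 ∷ 3 ∷ 1 ∷ []) ∷
  (7 , 7 ∷ 6 ∷ 8 ∷ 3 ∷ 1 ∷ 9 ∷ []) ∷
  (7 , 8 ∷ 7 ∷ 6 ∷ 0 ∷ 3 ∷ 1 ∷ []) ∷
  (8 , 8 ∷ 9 ∷ 6 ∷ 10 ∷ 3 ∷ 1 ∷ 11 ∷ []) ∷
  (8 , 9 ∷ 0 ∷ 8 ∷ 6 ∷ 0 ∷ 3 ∷ 1 ∷ []) ∷
  (9 , 10 ∷ 9 ∷ 8 ∷ 6 ∷ 0 ∷ 3 ∷ 1 ∷ []) ∷
  (10 , 10 ∷ 9 ∷ 8 ∷ 6 ∷ 12 ∷ 3 ∷ 1 ∷ 13 ∷ []) ∷
  (10 , 11 ∷ 0 ∷ 10 ∷ 8 ∷ 6 ∷ 0 ∷ 3 ∷ 1 ∷ []) ∷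
  (11 , 11 ∷ 12 ∷ 10 ∷ 8 ∷ 6 ∷ 13 ∷ 3 ∷ 1 ∷ 14 ∷ []) ∷
  (11 , 12 ∷ 11 ∷ 0 ∷ 10 ∷ 8 ∷ 6 ∷ 0 ∷ 3 ∷ 1 ∷ []) ∷
  (12 , 13 ∷ 11 ∷ 0 ∷ 10 ∷ 8 ∷ 6 ∷ 12 ∷ 3 ∷ 1 ∷ []) ∷
  (13 , 12 ∷ 13 ∷ 14 ∷ 10 ∷ 8 ∷ 6 ∷ 15 ∷ 3 ∷ 1 ∷ 16 ∷ []) ∷
  (13 , 13 ∷ 14 ∷ 12 ∷ 15 ∷ 10 ∷ 8 ∷ 6 ∷ 16 ∷ 3 ∷ 1 ∷ 17 ∷ []) ∷
  (13 , 14 ∷ 0 ∷ 13 ∷ 12 ∷ 0 ∷ 10 ∷ 8 ∷ 6 ∷ 0 ∷ 3 ∷ 1 ∷ []) ∷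
  (14 , 15 ∷ 0 ∷ 14 ∷ 12 ∷ 0 ∷ 10 ∷ 8 ∷ 6 ∷ 0 ∷ 3 ∷ 1 ∷ []) ∷
  (15 , 15 ∷ 16 ∷ 14 ∷ 17 ∷ 12 ∷ 10 ∷ 8 ∷ 6 ∷ 18 ∷ 3 ∷ 1 ∷ 19 ∷ []) ∷
  (15 , 16 ∷ 0 ∷ 15 ∷ 14 ∷ 0 ∷ 12 ∷ 10 ∷ 8 ∷ 6 ∷ 0 ∷ 3 ∷ 1 ∷ []) ∷
  (16 , 17 ∷ 16 ∷ 15 ∷ 0 ∷ 0 ∷ 12 ∷ 10 ∷ 8 ∷ 6 ∷ 0 ∷ 3 ∷ 1 ∷ []) ∷
  (17 , 17 ∷ 16 ∷ 18 ∷ 15 ∷ 19 ∷ 12 ∷ 10 ∷ 8 ∷ 6 ∷ 20 ∷ 3 ∷ 1 ∷ 21 ∷ []) ∷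
  (17 , 18 ∷ 0 ∷ 16 ∷ 17 ∷ 15 ∷ 0 ∷ 12 ∷ 10 ∷ 8 ∷ 6 ∷ 0 ∷ 3 ∷ 1 ∷ []) ∷
  (18 , 18 ∷ 17 ∷ 19 ∷ 16 ∷ 15 ∷ 20 ∷ 12 ∷ 10 ∷ 8 ∷ 6 ∷ 21 ∷ 3 ∷ 1 ∷ 22 ∷ []) ∷
  (18 , 19 ∷ 0 ∷ 18 ∷ 17 ∷ 0 ∷ 15 ∷ 0 ∷ 12 ∷ 10 ∷ 8 ∷ 6 ∷ 0 ∷ 3 ∷ 1 ∷ []) ∷
  (19 , 19 ∷ 20 ∷ 18 ∷ 17 ∷ 21 ∷ 15 ∷ 22 ∷ 12 ∷ 10 ∷ 8 ∷ 6 ∷ 23 ∷ 3 ∷ 1 ∷ 24 ∷ []) ∷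
  (19 , 20 ∷ 0 ∷ 0 ∷ 18 ∷ 19 ∷ 0 ∷ 15 ∷ 0 ∷ 12 ∷ 10 ∷ 8 ∷ 6 ∷ 0 ∷ 3 ∷ 1 ∷ []) ∷
  (20 , 21 ∷ 20 ∷ 19 ∷ 0 ∷ 18 ∷ 0 ∷ 15 ∷ 0 ∷ 12 ∷ 10 ∷ 8 ∷ 6 ∷ 0 ∷ 3 ∷ 1 ∷ []) ∷
  (21 , 21 ∷ 20 ∷ 22 ∷ 19 ∷ 18 ∷ 23 ∷ 15 ∷ 24 ∷ 12 ∷ 10 ∷ 8 ∷ 6 ∷ 25 ∷ 3 ∷ 1 ∷ 26 ∷ []) ∷
  (21 , 22 ∷ 21 ∷ 0 ∷ 20 ∷ 19 ∷ 18 ∷ 0 ∷ 15 ∷ 0 ∷ 12 ∷ 10 ∷ 8 ∷ 6 ∷ 0 ∷ 3 ∷ 1 ∷ []) ∷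
  (22 , 22 ∷ 23 ∷ 21 ∷ 20 ∷ 24 ∷ 18 ∷ 25 ∷ 15 ∷ 26 ∷ 12 ∷ 10 ∷ 8 ∷ 6 ∷ 27 ∷ 3 ∷ 1 ∷ 28 ∷ []) ∷
  []

nth : List ℕ → ℕ → ℕ
nth []       _       = 0
nth (x ∷ _)  zero    = x
nth (_ ∷ xs) (suc i) = nth xs i

entryIn : ℕ × List ℕ → ℕ → ℕ
entryIn (zero  , xs) q       = nth xs q
entryIn (suc k , xs) zero    = 0
entryIn (suc k , xs) (suc q) = entryIn (k , xs) q

entryAt : List (ℕ × List ℕ) → ℕ → ℕ → ℕ
entryAt []       _       _ = 0
entryAt (x ∷ _)  zero    q = entryIn x q
entryAt (_ ∷ xs) (suc p) q = entryAt xs p q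

open Table (entryAt table)
-- The table has 39 rows, `p = 0` to `38`, where 38 is the largest term to be certified. The
-- decision procedure runs during type checking.
open Certified 39
  (toWitness {a? = allUpTo? (λ p → allUpTo? (λ q → allUpTo? (correct? p q) (suc q)) (suc p)) 39} _)

-- Initial terms of the two sequences.

secondRowTerms thirdRowTerms : List ℕ
secondRowTerms =
  1 ∷ 3 ∷ 4 ∷ 6 ∷ 8 ∷ 10 ∷ 11 ∷ 13 ∷ 15 ∷ 16 ∷ 18 ∷ 20 ∷ 21 ∷ 24 ∷ 25 ∷ 27 ∷ []
thirdRowTerms =
  2 ∷ 5 ∷ 7 ∷ 9 ∷ 12 ∷ 14 ∷ 17 ∷ 19 ∷ 22 ∷ 23 ∷ 26 ∷ 29 ∷ 31 ∷ 33 ∷ 36 ∷ 38 ∷ []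

-- `B` certifies absence from `A`: each positive `n ≤ k` outside `xs` is shown to lie in the
-- disjoint `B`, which is instantiated with table membership for the other sequence. Anything beyond
-- `k` exceeds all of `xs`.
firstTerms : ∀ {A B : ℕ → Set} xs k → Linked _<_ xs → All A xs → All (_< suc k) xs →
             (∀ {n} → A n → 1 ≤ n) → (∀ {n} → A n → ¬ B n) →
             (∀ {n} → n < suc k → n ≡ 0 ⊎ n ∈ xs ⊎ B n) → FirstTerms A xs
firstTerms {A} xs k increasing members bounded positive disjoint split = record
  { increasing = increasing
  ; members    = members
  ; complete   = complete
  }
  where
  complete : ∀ {n} → A n → n ∈ xs ⊎ All (_< n) xs
  complete {n} An with n <? suc k
  ... | no n≮1+k = inj₂ (All.map (λ x<1+k → <-≤-trans x<1+k (≮⇒≥ n≮1+k)) bounded)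
  ... | yes n<1+k with split n<1+k
  ...   | inj₁ refl        = contradiction (positive An) (n≮n 0)
  ...   | inj₂ (inj₁ n∈xs) = inj₁ n∈xs
  ...   | inj₂ (inj₂ Bn)   = contradiction Bn (disjoint An)

firstTerms-second : FirstTerms A029900 secondRowTerms
-- The cut-off is the last listed term, here 27 and for the third row 38.
firstTerms-second = firstTerms {B = InTable₃} secondRowTerms 27
  (toWitness {a? = linked? _<?_ secondRowTerms} _)
  (All.map (proj₂ A029900≐D ∘ inTable₂⇒D) (toWitness {a? = All.all? inTable₂? secondRowTerms} _))
  (toWitness {a? = All.all? (_<? 28) secondRowTerms} _)
  proj₁ (λ {n} n∈A n∈B → DS-disjoint {n} (proj₁ A029900≐D n∈A) (inTable₃⇒S n∈B))
  (toWitness {a? = allUpTo? (λ n → n ≟ 0 ⊎-dec (n ∈? secondRowTerms) ⊎-dec inTable₃? n) 28} _)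

firstTerms-third : FirstTerms A029901 thirdRowTerms
firstTerms-third = firstTerms {B = InTable₂} thirdRowTerms 38
  (toWitness {a? = linked? _<?_ thirdRowTerms} _)
  (All.map (proj₂ A029901≐S ∘ inTable₃⇒S) (toWitness {a? = All.all? inTable₃? thirdRowTerms} _))
  (toWitness {a? = All.all? (_<? 39) thirdRowTerms} _)
  proj₁ (λ {n} n∈A n∈B → DS-disjoint {n} (inTable₂⇒D n∈B) (proj₁ A029901≐S n∈A))
  (toWitness {a? = allUpTo? (λ n → n ≟ 0 ⊎-dec (n ∈? thirdRowTerms) ⊎-dec inTable₂? n) 39} _)

corollary4p5 :
    ((n : ℕ) → 1 ≤ n →
        ∃! _≡_ (Winning {rectangle n})
      × ((m : Move (rectangle n)) → Winning m →
            row m ≢ first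
          × (row m ≡ second ⇔ D n)
          × (row m ≡ second →
                ∃! _≡_ (λ a → n ≡ f a a ≤-refl)
              × ((a : ℕ) → n ≡ f a a ≤-refl →
                   Σ (a < n) λ a<n →
                     play (rectangle n) m ≡ pos n a a (<⇒≤ a<n) ≤-refl))
          × (row m ≡ third ⇔ S n)
          × (row m ≡ third →
                ∃! _≡_ (λ r → Σ (r < n) λ r<n → f n r (<⇒≤ r<n) ≡ n)
              × ((r : ℕ) (r<n : r < n) → f n r (<⇒≤ r<n) ≡ n →
                   play (rectangle n) m ≡ pos n n r ≤-refl (<⇒≤ r<n)))))
  × (A029900 ≐ D)
  × (A029901 ≐ S)
  × FirstTerms A029900
      (1 ∷ 3 ∷ 4 ∷ 6 ∷ 8 ∷ 10 ∷ 11 ∷ 13 ∷ 15 ∷ 16 ∷ 18 ∷ 20 ∷ 21 ∷ 24 ∷ 25 ∷ 27 ∷ [])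
  × FirstTerms A029901
      (2 ∷ 5 ∷ 7 ∷ 9 ∷ 12 ∷ 14 ∷ 17 ∷ 19 ∷ 22 ∷ 23 ∷ 26 ∷ 29 ∷ 31 ∷ 33 ∷ 36 ∷ 38 ∷ [])
corollary4p5 =
    (λ n 1≤n → opening-unique n 1≤n , λ m w → opening (view m w))
  , A029900≐D , A029901≐S , firstTerms-second , firstTerms-third
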